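{- Let $k\ge1$. Let $T_k(x)=\sum_{n\ge1}t_{n,k}x^n$, where $t_{n,k}$ is the total number, over all Schroeder trees with $n$ leaves, of vertices having a subtree of size $k$. Let $R_k(x)=\sum_{n\ge1}r_{n,k}x^n$, where $r_{n,k}$ is the number of Schroeder trees with $n$ leaves and exactly $k$ vertices in total. Then $$T_k(x)=R_k(x)\,\frac{3-x+\sqrt{1-6x+x^2}}{4\sqrt{1-6x+x^2}}.$$
   Context: A Schroeder tree is a finite rooted plane tree (the children of each vertex are linearly ordered) in which every non-leaf vertex has at least two children. A leaf is a vertex with no children; the one-vertex tree is a Schroeder tree with one leaf. Trees are counted up to isomorphism of rooted plane trees. A vertex $v$ has a subtree of size $k$ if the subtree consisting of $v$ and all its descendants has exactly $k$ vertices. $\sqrt{1-6x+x^2}$ denotes the formal power series square root with constant term $1$. -}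

module Defs where

open import Data.Nat.Base as ℕ using (ℕ; zero; suc; _∸_; _≤_; z≤n; s≤s)
import Data.Nat.Properties as ℕₚ
open import Data.Nat.Induction using (<-rec)
import Data.Integer.Base as ℤ
open import Data.Rational using (ℚ; 0ℚ; 1ℚ; ½; _+_; _*_; _-_; -_; _/_; 1/_; NonZero)
import Data.Rational.Properties as ℚₚ
open import Data.Fin.Base using (Fin; zero; suc; toℕ; inject₁; fromℕ; opposite)
import Data.Fin.Properties as Finₚ
open import Data.Vec.Base using (Vec; []; _∷_; lookup)
open import Data.Vec.Functional using (Vector)
open import Data.List.Base
  using (List; []; _∷_; _++_; length; filter; map; cartesianProductWith)
open import Data.Nat.ListAction using (sum)
open import Data.List.Membership.Propositional using (_∈_)
open import Data.List.Membership.Propositional.Properties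
  using (∈-cartesianProductWith⁺; ∈-cartesianProductWith⁻; ∈-filter⁺; ∈-filter⁻)
open import Data.List.Relation.Unary.Any using (here; there)
open import Data.List.Relation.Unary.All as All using (All; []; _∷_)
open import Data.List.Relation.Unary.Unique.Propositional using (Unique; []; _∷_)
open import Data.List.Relation.Unary.Unique.Propositional.Properties
  using (cartesianProductWith⁺; filter⁺)
open import Data.Product.Base using (_×_; _,_; proj₂)
open import Function.Base using (_∘_; _$_)
open import Relation.Binary.PropositionalEquality
  using (_≡_; _≢_; refl; sym; trans; cong; cong₂; subst; module ≡-Reasoning)
open import Algebra.Bundles using (CommutativeRing)
open import Algebra.Properties.Semiring.Sum
  (CommutativeRing.semiring ℚₚ.+-*-commutativeRing)
  using (sum-syntax; sum⁺-syntax; sum-init-last; sum-cong-≗)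

-- An internal vertex has a first child, a second child and a list of
-- further children.  Two trees are isomorphic as rooted plane trees iff
-- they are propositionally equal.

data Tree : Set where
  leaf : Tree
  node : (t₁ t₂ : Tree) (ts : List Tree) → Tree

mutual
  leaves : Tree → ℕ
  leaves leaf           = 1
  leaves (node t u ts) = leaves t ℕ.+ leaves u ℕ.+ leaves* ts

  leaves* : List Tree → ℕ
  leaves* []       = 0
  leaves* (t ∷ ts) = leaves t ℕ.+ leaves* ts

mutual
  size : Tree → ℕ
  size leaf           = 1
  size (node t u ts) = suc (size t ℕ.+ size u ℕ.+ size* ts)

  size* : List Tree → ℕ
  size* []       = 0
  size* (t ∷ ts) = size t ℕ.+ size* ts

-- One entry per vertex v, namely the subtree formed by v and its
-- descendants; equal subtrees at different vertices are listed separately.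

mutual
  subtrees : Tree → List Tree
  subtrees leaf           = leaf ∷ []
  subtrees (node t u ts) = node t u ts ∷ subtrees t ++ subtrees u ++ subtrees* ts

  subtrees* : List Tree → List Tree
  subtrees* []       = []
  subtrees* (t ∷ ts) = subtrees t ++ subtrees* ts

#verticesOfSize : ℕ → Tree → ℕ
#verticesOfSize k t = length (filter (λ s → size s ℕₚ.≟ k) (subtrees t))

record Enumeration {A : Set} (P : A → Set) : Set where
  field
    list     : List A
    sound    : ∀ {x} → x ∈ list → P x
    complete : ∀ {x} → P x → x ∈ list
    unique   : Unique list

nodeWith : Tree → (Tree × List Tree) → Tree
nodeWith t (u , us) = node t u us

-- All trees, respectively forests, whose term has nesting depth at most the
-- argument; a tree with n leaves has depth at most n, a forest at most 1 + n.

mutual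
  boundedTrees : ℕ → List Tree
  boundedTrees zero    = []
  boundedTrees (suc d) =
    leaf ∷ cartesianProductWith nodeWith (boundedTrees d)
             (cartesianProductWith _,_ (boundedTrees d) (boundedForests d))

  boundedForests : ℕ → List (List Tree)
  boundedForests zero    = []
  boundedForests (suc d) =
    [] ∷ cartesianProductWith _∷_ (boundedTrees d) (boundedForests d)

1≤leaves : ∀ t → 1 ≤ leaves t
1≤leaves leaf          = s≤s z≤n
1≤leaves (node t u ts) =
  ℕₚ.≤-trans (1≤leaves t)
    (ℕₚ.≤-trans (ℕₚ.m≤m+n (leaves t) (leaves u)) (ℕₚ.m≤m+n _ (leaves* ts)))

private
  step : ∀ {a b d} → 1 ≤ a → a ℕ.+ b ≤ suc d → b ≤ d
  step {b = b} p q = ℕₚ.≤-pred (ℕₚ.≤-trans (ℕₚ.+-monoˡ-≤ b p) q)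

mutual
  boundedTrees-complete : ∀ t d → leaves t ≤ d → t ∈ boundedTrees d
  boundedTrees-complete t zero p with () ← ℕₚ.≤-trans (1≤leaves t) p
  boundedTrees-complete leaf          (suc d) p = here refl
  boundedTrees-complete (node t u ts) (suc d) p = there $
    ∈-cartesianProductWith⁺ nodeWith
      (boundedTrees-complete t d
        (ℕₚ.≤-trans (ℕₚ.m≤m+n _ (leaves* ts)) (step (1≤leaves u) u+[t+ts]≤)))
      (∈-cartesianProductWith⁺ _,_
        (boundedTrees-complete u d (ℕₚ.≤-trans (ℕₚ.m≤m+n _ _) u+ts≤d))
        (boundedForests-complete ts d (ℕₚ.≤-trans (ℕₚ.+-monoˡ-≤ _ (1≤leaves u)) u+ts≤d)))
    where
    t+[u+ts]≤ : leaves t ℕ.+ (leaves u ℕ.+ leaves* ts) ≤ suc d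
    t+[u+ts]≤ = subst (_≤ suc d) (ℕₚ.+-assoc (leaves t) _ _) p

    u+ts≤d : leaves u ℕ.+ leaves* ts ≤ d
    u+ts≤d = step (1≤leaves t) t+[u+ts]≤

    u+[t+ts]≤ : leaves u ℕ.+ (leaves t ℕ.+ leaves* ts) ≤ suc d
    u+[t+ts]≤ = subst (_≤ suc d)
      (trans (cong (ℕ._+ leaves* ts) (ℕₚ.+-comm (leaves t) (leaves u)))
             (ℕₚ.+-assoc (leaves u) _ _)) p

  boundedForests-complete : ∀ ts d → suc (leaves* ts) ≤ d → ts ∈ boundedForests d
  boundedForests-complete []       (suc d) p       = here refl
  boundedForests-complete (t ∷ ts) (suc d) (s≤s p) = there $
    ∈-cartesianProductWith⁺ _∷_
      (boundedTrees-complete t d (ℕₚ.≤-trans (ℕₚ.m≤m+n _ _) p))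
      (boundedForests-complete ts d (ℕₚ.≤-trans (ℕₚ.+-monoˡ-≤ _ (1≤leaves t)) p))

mutual
  boundedTrees-unique : ∀ d → Unique (boundedTrees d)
  boundedTrees-unique zero    = []
  boundedTrees-unique (suc d) =
    All.tabulate leaf≢ ∷
    cartesianProductWith⁺ nodeWith (λ { refl → refl , refl }) (boundedTrees-unique d)
      (cartesianProductWith⁺ _,_ (λ { refl → refl , refl })
        (boundedTrees-unique d) (boundedForests-unique d))
    where
    leaf≢ : ∀ {t} → t ∈ _ → leaf ≢ t
    leaf≢ t∈ refl with _ , _ , _ , _ , () ←
      ∈-cartesianProductWith⁻ nodeWith (boundedTrees d) _ t∈

  boundedForests-unique : ∀ d → Unique (boundedForests d)
  boundedForests-unique zero    = []
  boundedForests-unique (suc d) =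
    All.tabulate []≢ ∷
    cartesianProductWith⁺ _∷_ (λ { refl → refl , refl })
      (boundedTrees-unique d) (boundedForests-unique d)
    where
    []≢ : ∀ {ts} → ts ∈ _ → [] ≢ ts
    []≢ ts∈ refl with _ , _ , _ , _ , () ←
      ∈-cartesianProductWith⁻ _∷_ (boundedTrees d) _ ts∈

treesWithLeaves : ∀ n → Enumeration (λ t → leaves t ≡ n)
treesWithLeaves n = record
  { list     = filter hasLeaves? (boundedTrees n)
  ; sound    = λ t∈ → proj₂ (∈-filter⁻ hasLeaves? {xs = boundedTrees n} t∈)
  ; complete = λ {t} p → ∈-filter⁺ hasLeaves?
                 (boundedTrees-complete t n (ℕₚ.≤-reflexive p)) p
  ; unique   = filter⁺ hasLeaves? (boundedTrees-unique n)
  }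
  where hasLeaves? = λ t → leaves t ℕₚ.≟ n

-- The coefficients r_{n,k} = treeCount n k and t_{n,k} = vertexCount n k.

treeCount : ℕ → ℕ → ℕ
treeCount n k =
  length (filter (λ t → size t ℕₚ.≟ k) (Enumeration.list (treesWithLeaves n)))

vertexCount : ℕ → ℕ → ℕ
vertexCount n k =
  sum (map (#verticesOfSize k) (Enumeration.list (treesWithLeaves n)))

PowerSeries : Set
PowerSeries = ℕ → ℚ

infix  4 _≈_
infixl 6 _⊕_ _⊖_
infixl 7 _⊗_ _⊘_
infix  8 √_ _⁻¹

_≈_ : PowerSeries → PowerSeries → Set
A ≈ B = ∀ n → A n ≡ B n

ℕ→ℚ : ℕ → ℚ
ℕ→ℚ n = ℤ.+ n / 1

const : ℕ → PowerSeries
const c zero    = ℕ→ℚ c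
const c (suc _) = 0ℚ

X : PowerSeries
X 1 = 1ℚ
X _ = 0ℚ

_⊕_ _⊖_ _⊗_ : PowerSeries → PowerSeries → PowerSeries
(A ⊕ B) n = A n + B n
(A ⊖ B) n = A n - B n
(A ⊗ B) n = ∑[ i ≤ n ] (A (toℕ i) * B (n ∸ toℕ i))

-- Course-of-values recursion: the n-th coefficient is computed by f from
-- coefficients 0, …, n - 1.  The vector of earlier coefficients is stored
-- most recent first.

module _ (f : ∀ n → Vector ℚ n → ℚ) where

  earlier : ∀ n → Vec ℚ n
  recurse : PowerSeries

  earlier zero    = []
  earlier (suc n) = recurse n ∷ earlier n

  recurse n = f n (λ i → lookup (earlier n) (opposite i))

  private
    lookup-earlier′ : ∀ n i → lookup (earlier n) i ≡ recurse (toℕ (opposite i))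
    lookup-earlier′ (suc n) zero    = cong recurse (sym (Finₚ.toℕ-fromℕ n))
    lookup-earlier′ (suc n) (suc i) =
      trans (lookup-earlier′ n i) (cong recurse (sym (Finₚ.toℕ-inject₁ (opposite i))))

  lookup-earlier : ∀ n i → lookup (earlier n) (opposite i) ≡ recurse (toℕ i)
  lookup-earlier n i = trans (lookup-earlier′ n (opposite i))
    (cong (recurse ∘ toℕ) (Finₚ.opposite-involutive i))

-- Solving A ⁻¹ ⊗ A = 1 for the coefficients of A ⁻¹.

_⁻¹ : (A : PowerSeries) .{{_ : NonZero (A 0)}} → PowerSeries
A ⁻¹ = recurse coefficient
  module Inverse where
  coefficient : ∀ n → Vector ℚ n → ℚ
  coefficient zero    _ = 1/ A 0
  coefficient (suc n) b = - (∑[ i ≤ n ] (b i * A (suc n ∸ toℕ i)) * 1/ A 0)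

_⊘_ : (A B : PowerSeries) .{{_ : NonZero (B 0)}} → PowerSeries
A ⊘ B = A ⊗ B ⁻¹

-- Solving S ⊗ S = A with S 0 = 1 for the coefficients of S, which is
-- possible when A 0 = 1.  The sum is S₁ Sₙ + S₂ Sₙ₋₁ + … + Sₙ S₁.

√_ : PowerSeries → PowerSeries
√ A = recurse coefficient
  module SquareRoot where
  coefficient : ∀ n → Vector ℚ n → ℚ
  coefficient zero    _ = 1ℚ
  coefficient (suc n) s =
    ½ * (A (suc n) - ∑[ i < n ] (s (suc i) * s (opposite (inject₁ i))))

⁻¹-inverseˡ : ∀ A .{{_ : NonZero (A 0)}} → A ⁻¹ ⊗ A ≈ const 1
⁻¹-inverseˡ A zero    = trans (ℚₚ.+-identityʳ _) (ℚₚ.*-inverseˡ (A 0))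
⁻¹-inverseˡ A (suc n) = begin
  ∑[ i ≤ suc n ] (B (toℕ i) * A (suc n ∸ toℕ i))
    ≡⟨ sum-init-last (λ (i : Fin (suc (suc n))) → B (toℕ i) * A (suc n ∸ toℕ i)) ⟩
  ∑[ i ≤ n ] (B (toℕ (inject₁ i)) * A (suc n ∸ toℕ (inject₁ i)))
    + B (toℕ (fromℕ (suc n))) * A (suc n ∸ toℕ (fromℕ (suc n)))
    ≡⟨ cong₂ _+_
         (sum-cong-≗ {suc n} (λ i → cong (λ j → B j * A (suc n ∸ j)) (Finₚ.toℕ-inject₁ i)))
         (trans (cong (λ j → B j * A (suc n ∸ j)) (Finₚ.toℕ-fromℕ (suc n)))
                (cong (λ j → B (suc n) * A j) (ℕₚ.n∸n≡0 n))) ⟩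
  Σ + B (suc n) * A 0
    ≡⟨ cong (λ b → Σ + b * A 0) (cong (λ x → - (x * 1/ A 0)) (sum-cong-≗ {suc n} (λ i →
         cong (_* A (suc n ∸ toℕ i)) (lookup-earlier (Inverse.coefficient A) (suc n) i)))) ⟩
  Σ + - (Σ * 1/ A 0) * A 0
    ≡⟨ cong (λ x → Σ + x) (sym (ℚₚ.neg-distribˡ-* (Σ * 1/ A 0) (A 0))) ⟩
  Σ - Σ * 1/ A 0 * A 0
    ≡⟨ cong (λ x → Σ - x) (trans (ℚₚ.*-assoc Σ _ _)
         (trans (cong (Σ *_) (ℚₚ.*-inverseˡ (A 0))) (ℚₚ.*-identityʳ Σ))) ⟩
  Σ - Σ
    ≡⟨ ℚₚ.+-inverseʳ Σ ⟩
  0ℚ ∎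
  where
  open ≡-Reasoning
  B : PowerSeries
  B = A ⁻¹
  Σ : ℚ
  Σ = ∑[ i ≤ n ] (B (toℕ i) * A (suc n ∸ toℕ i))

innerSquare : PowerSeries → ℕ → ℚ
innerSquare S n = ∑[ i < n ] (S (suc (toℕ i)) * S (n ∸ toℕ i))

square-suc : ∀ S → S 0 ≡ 1ℚ → ∀ n →
             (S ⊗ S) (suc n) ≡ S (suc n) + S (suc n) + innerSquare S n
square-suc S S₀ n = begin
  S 0 * S (suc n) + ∑[ i ≤ n ] (S (suc (toℕ i)) * S (n ∸ toℕ i))
    ≡⟨ cong₂ _+_ (trans (cong (_* S (suc n)) S₀) (ℚₚ.*-identityˡ (S (suc n))))
         (sum-init-last (λ (i : Fin (suc n)) → S (suc (toℕ i)) * S (n ∸ toℕ i))) ⟩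
  S (suc n) + (∑[ i < n ] (S (suc (toℕ (inject₁ i))) * S (n ∸ toℕ (inject₁ i)))
    + S (suc (toℕ (fromℕ n))) * S (n ∸ toℕ (fromℕ n)))
    ≡⟨ cong (S (suc n) +_) (cong₂ _+_
         (sum-cong-≗ {n} (λ i → cong (λ j → S (suc j) * S (n ∸ j)) (Finₚ.toℕ-inject₁ i)))
         (trans (cong (λ j → S (suc j) * S (n ∸ j)) (Finₚ.toℕ-fromℕ n))
           (trans (cong (S (suc n) *_) (trans (cong S (ℕₚ.n∸n≡0 n)) S₀))
                  (ℚₚ.*-identityʳ (S (suc n)))))) ⟩
  S (suc n) + (innerSquare S n + S (suc n))
    ≡⟨ cong (S (suc n) +_) (ℚₚ.+-comm (innerSquare S n) _) ⟩
  S (suc n) + (S (suc n) + innerSquare S n)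
    ≡⟨ ℚₚ.+-assoc (S (suc n)) _ _ ⟨
  S (suc n) + S (suc n) + innerSquare S n ∎
  where open ≡-Reasoning

√-suc : ∀ A n → (√ A) (suc n) ≡ ½ * (A (suc n) - innerSquare (√ A) n)
√-suc A n = cong (λ x → ½ * (A (suc n) - x)) (sum-cong-≗ {n} λ i → cong₂ _*_
  (lookup-earlier (SquareRoot.coefficient A) (suc n) (suc i))
  (trans (lookup-earlier (SquareRoot.coefficient A) (suc n) (opposite (inject₁ i)))
         (cong (√ A) (trans (Finₚ.opposite-prop (inject₁ i))
                            (cong (n ∸_) (Finₚ.toℕ-inject₁ i))))))

half+half : ∀ q → ½ * q + ½ * q ≡ q
half+half q = trans (sym (ℚₚ.*-distribʳ-+ q ½ ½)) (ℚₚ.*-identityˡ q)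

√-square : ∀ A → A 0 ≡ 1ℚ → √ A ⊗ √ A ≈ A
√-square A A₀ zero    = sym A₀
√-square A A₀ (suc n) = begin
  (√ A ⊗ √ A) (suc n)                 ≡⟨ square-suc (√ A) refl n ⟩
  (√ A) (suc n) + (√ A) (suc n) + I   ≡⟨ cong (λ s → s + s + I) (√-suc A n) ⟩
  ½ * (A (suc n) - I) + ½ * (A (suc n) - I) + I ≡⟨ cong (_+ I) (half+half (A (suc n) - I)) ⟩
  A (suc n) - I + I                   ≡⟨ ℚₚ.+-assoc (A (suc n)) (- I) I ⟩
  A (suc n) + (- I + I)               ≡⟨ cong (A (suc n) +_) (ℚₚ.+-inverseˡ I) ⟩
  A (suc n) + 0ℚ                      ≡⟨ ℚₚ.+-identityʳ _ ⟩
  A (suc n)                           ∎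
  where
  open ≡-Reasoning
  I = innerSquare (√ A) n

√-unique : ∀ A S → S 0 ≡ 1ℚ → S ⊗ S ≈ A → S ≈ √ A
√-unique A S S₀ S²≈A = <-rec (λ n → S n ≡ (√ A) n) go
  where
  open ≡-Reasoning
  go : ∀ n → (∀ {m} → m ℕ.< n → S m ≡ (√ A) m) → S n ≡ (√ A) n
  go zero    _  = S₀
  go (suc n) ih = begin
    s                           ≡⟨ half+half s ⟨
    ½ * s + ½ * s               ≡⟨ ℚₚ.*-distribˡ-+ ½ s s ⟨
    ½ * (s + s)                 ≡⟨ cong (½ *_) (ℚₚ.+-identityʳ (s + s)) ⟨
    ½ * (s + s + 0ℚ)            ≡⟨ cong (λ x → ½ * (s + s + x)) (ℚₚ.+-inverseʳ I) ⟨
    ½ * (s + s + (I - I))       ≡⟨ cong (½ *_) (ℚₚ.+-assoc (s + s) I (- I)) ⟨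
    ½ * (s + s + I - I)         ≡⟨ cong (λ x → ½ * (x - I))
                                     (trans (sym (square-suc S S₀ n)) (S²≈A (suc n))) ⟩
    ½ * (A (suc n) - I)         ≡⟨ cong (λ x → ½ * (A (suc n) - x)) (sum-cong-≗ {n} λ i →
                                     cong₂ _*_ (ih (s≤s (Finₚ.toℕ<n i)))
                                               (ih (s≤s (ℕₚ.m∸n≤m n (toℕ i))))) ⟩
    ½ * (A (suc n) - innerSquare (√ A) n) ≡⟨ √-suc A n ⟨
    (√ A) (suc n)               ∎
    where
    s = S (suc n)
    I = innerSquare S n

R T : ℕ → PowerSeries
R k zero    = 0ℚ
R k (suc n) = ℕ→ℚ (treeCount (suc n) k)
T k zero    = 0ℚ
T k (suc n) = ℕ→ℚ (vertexCount (suc n) k)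

{-# OPTIONS --safe #-}

-- Mark a vertex.  Let A and L count trees and forests by leaves, V and F trees
-- and forests with a marked vertex heading a subtree of size k, and P the trees
-- of size k.  Decomposing a tree at its root and a forest at its first tree gives
--   A = x + A² L,  L = 1 + A L,  V = P + 2 V A L + A² F,  F = V L + A F.
-- Eliminating L and F leaves S V = (1 - A) P with S = 1 + x - 4 A, and the
-- quadratic equation of A says S² = 1 - 6 x + x².

module Submission where

open import Defs
open import Level using (0ℓ)
open import Data.Nat.Base as ℕ using (ℕ; zero; suc; _≤_; s≤s)
import Data.Nat.Properties as ℕₚ
import Data.Integer.Base as ℤ
import Data.Integer.Properties as ℤₚ
open import Data.Rational using (ℚ; 0ℚ; 1ℚ; _+_; _*_; -_; toℚᵘ)
import Data.Rational.Properties as ℚₚ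
open import Data.Rational.Solver using (module +-*-Solver)
import Data.Rational.Unnormalised.Base as ℚᵘ
import Data.Rational.Unnormalised.Properties as ℚᵘₚ
open import Data.Fin.Base using (toℕ)
import Data.Fin.Properties as Finₚ
open import Data.List.Base
  using (List; []; _∷_; _++_; drop; length; filter; map; cartesianProductWith)
import Data.List.Properties as Listₚ
open import Data.List.Membership.Propositional using (_∈_)
open import Data.List.Membership.Propositional.Properties using (∈-filter⁺; ∈-filter⁻)
open import Data.List.Membership.Propositional.Properties.WithK using (unique∧set⇒bag)
open import Data.List.Relation.Binary.BagAndSetEquality using (∼bag⇒↭)
open import Data.List.Relation.Binary.Permutation.Propositional.Properties using (map⁺)
open import Data.List.Relation.Unary.Unique.Propositional using (Unique)
open import Data.List.Relation.Unary.Unique.Propositional.Properties using (filter⁺)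
open import Data.Maybe.Base as Maybe using (Maybe)
open import Data.Nat.ListAction using (sum)
open import Data.Nat.ListAction.Properties using (sum-↭)
open import Data.Product.Base using (_×_; _,_; proj₂)
open import Function.Base using (_∘_)
open import Function.Bundles using (mk⇔)
open import Algebra.Bundles using (CommutativeMonoid; Semiring; CommutativeRing)
open import Algebra.Properties.Semiring.Sum
  (CommutativeRing.semiring ℚₚ.+-*-commutativeRing) using (sum-cong-≗)
import Algebra.Solver.Ring as RingSolver
open import Algebra.Solver.Ring.AlmostCommutativeRing
  using (fromCommutativeRing; _-Raw-AlmostCommutative⟶_)
open import Relation.Nullary.Decidable using (yes; no; dec⇒maybe)
open import Relation.Nullary.Negation using (contradiction)
open import Relation.Binary.PropositionalEquality
  using (_≡_; _≢_; refl; sym; trans; cong; cong₂; module ≡-Reasoning)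

-- Elimination in an abstract commutative ring over the rationals.

module SchroederAlgebra
  (K : CommutativeRing 0ℓ 0ℓ)
  (embedding : CommutativeRing.rawRing ℚₚ.+-*-commutativeRing
                 -Raw-AlmostCommutative⟶ fromCommutativeRing K)
  where

  private module K = CommutativeRing K
  open K using (Carrier; 0#)
    renaming (_+_ to _⊞_; _*_ to _⊠_; _-_ to _⊟_; -_ to ⊟_; _≈_ to _≋_)
  open import Relation.Binary.Reasoning.Setoid K.setoid
  open _-Raw-AlmostCommutative⟶_ embedding using (⟦_⟧)

  # : ℕ → Carrier
  # n = ⟦ ℕ→ℚ n ⟧

  private
    ⟦⟧≟ : ∀ p q → Maybe (⟦ p ⟧ ≋ ⟦ q ⟧)
    ⟦⟧≟ p q = Maybe.map (λ p≡q → K.reflexive (cong ⟦_⟧ p≡q)) (dec⇒maybe (p ℚₚ.≟ q))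

  open RingSolver (CommutativeRing.rawRing ℚₚ.+-*-commutativeRing)
    (fromCommutativeRing K) embedding ⟦⟧≟
    using (Polynomial; solve; con; _:+_; _:*_; _:-_; :-_; _:=_)

  private
    numeral : ∀ {m} → ℕ → Polynomial m
    numeral n = con (ℕ→ℚ n)

    difference≈0 : ∀ {y z} → y ≋ z → z ⊟ y ≋ 0#
    difference≈0 {y} {z} y≈z = K.trans (K.+-congˡ (K.-‿cong y≈z)) (K.-‿inverseʳ z)

    0-multiple : ∀ y {z} → z ≋ 0# → y ⊠ z ≋ 0#
    0-multiple y z≈0 = K.trans (K.*-congˡ z≈0) (K.zeroʳ y)

    0-sum : ∀ {y z} → y ≋ 0# → z ≋ 0# → y ⊞ z ≋ 0#
    0-sum y≈0 z≈0 = K.trans (K.+-cong y≈0 z≈0) (K.+-identityʳ 0#)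

    add-0 : ∀ y {z} → z ≋ 0# → y ⊞ z ≋ y
    add-0 y z≈0 = K.trans (K.+-congˡ z≈0) (K.+-identityʳ y)

  module _ {x A L : Carrier}
    (A-eq : A ≋ x ⊞ A ⊠ (A ⊠ L))
    (L-eq : L ≋ # 1 ⊞ A ⊠ L)
    where

    -- Since `(1 - A) L = 1`, multiplying the equation of `A` by `1 - A` gives
    -- `2 A² - (1 + x) A + x = 0`. The discriminant of this quadratic in `A` is `1 - 6 x + x²`, and
    -- `S` is the square root isolated by the quadratic formula.
    S : Carrier
    S = # 1 ⊞ x ⊟ # 4 ⊠ A

    -- In the next two proofs the added summands are multiples of right side minus
    -- left side of the hypotheses, with the multipliers of the elimination.
    S-square : S ⊠ S ≋ # 1 ⊟ # 6 ⊠ x ⊞ x ⊠ x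
    S-square = begin
      S ⊠ S
        ≈⟨ solve 3 (λ x A L →
             let S = numeral 1 :+ x :- numeral 4 :* A in
             S :* S :=
             numeral 1 :- numeral 6 :* x :+ x :* x
               :+ (numeral 8 :* (numeral 1 :- A) :* (x :+ A :* (A :* L) :- A)
                   :+ numeral 8 :* A :* A :* (numeral 1 :+ A :* L :- L)))
             K.refl x A L ⟩
      # 1 ⊟ # 6 ⊠ x ⊞ x ⊠ x
        ⊞ (# 8 ⊠ (# 1 ⊟ A) ⊠ (x ⊞ A ⊠ (A ⊠ L) ⊟ A) ⊞ # 8 ⊠ A ⊠ A ⊠ (# 1 ⊞ A ⊠ L ⊟ L))
        ≈⟨ add-0 _ (0-sum (0-multiple _ (difference≈0 A-eq))
                          (0-multiple _ (difference≈0 L-eq))) ⟩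
      # 1 ⊟ # 6 ⊠ x ⊞ x ⊠ x ∎

    module _ {P V F : Carrier}
      (V-eq : V ≋ P ⊞ (V ⊠ (A ⊠ L) ⊞ A ⊠ (V ⊠ L ⊞ A ⊠ F)))
      (F-eq : F ≋ V ⊠ L ⊞ A ⊠ F)
      where

      -- Multiply the equation of `V` by `1 - A`. With `(1 - A) L = 1`, `(1 - A) F = V L` and
      -- `A² L = A - x` it becomes `(1 - A) V = (1 - A) P + 2 A V + (A - x) V`, that is `S V = (1 -
      -- A) P`. The factor 4 turns `1 - A` into `3 - x + S`.
      V*4S : V ⊠ (# 4 ⊠ S) ≋ P ⊠ (# 3 ⊟ x ⊞ S)
      V*4S = begin
        V ⊠ (# 4 ⊠ S)
          ≈⟨ solve 6 (λ x A L P V F →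
               let S = numeral 1 :+ x :- numeral 4 :* A in
               V :* (numeral 4 :* S) :=
               P :* (numeral 3 :- x :+ S)
               :+ (numeral 4 :* (A :- numeral 1)
                    :* (P :+ (V :* (A :* L) :+ A :* (V :* L :+ A :* F)) :- V)
                :+ (:- (numeral 4 :* A :* A) :* (V :* L :+ A :* F :- F)
                :+ (:- (numeral 8 :* V :* A) :* (numeral 1 :+ A :* L :- L)
                :+ numeral 4 :* V :* (x :+ A :* (A :* L) :- A)))))
               K.refl x A L P V F ⟩
        P ⊠ (# 3 ⊟ x ⊞ S)
        ⊞ (# 4 ⊠ (A ⊟ # 1) ⊠ (P ⊞ (V ⊠ (A ⊠ L) ⊞ A ⊠ (V ⊠ L ⊞ A ⊠ F)) ⊟ V)
         ⊞ (⊟ (# 4 ⊠ A ⊠ A) ⊠ (V ⊠ L ⊞ A ⊠ F ⊟ F)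
         ⊞ (⊟ (# 8 ⊠ V ⊠ A) ⊠ (# 1 ⊞ A ⊠ L ⊟ L)
         ⊞ # 4 ⊠ V ⊠ (x ⊞ A ⊠ (A ⊠ L) ⊟ A))))
          ≈⟨ add-0 _ (0-sum (0-multiple _ (difference≈0 V-eq))
                     (0-sum (0-multiple _ (difference≈0 F-eq))
                     (0-sum (0-multiple _ (difference≈0 L-eq))
                            (0-multiple _ (difference≈0 A-eq))))) ⟩
        P ⊠ (# 3 ⊟ x ⊞ S) ∎

-- Finite sums over lists in a semiring.

module ListSum (K : Semiring 0ℓ 0ℓ) where
  private module K = Semiring K
  open K using (Carrier; 0#) renaming (_+_ to _⊞_; _*_ to _⊠_; _≈_ to _≋_)
  open import Relation.Binary.Reasoning.Setoid K.setoid
  open import Algebra.Properties.CommutativeSemigroup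
    (CommutativeMonoid.commutativeSemigroup K.+-commutativeMonoid) using (interchange)

  ∑ : {B : Set} → (B → Carrier) → List B → Carrier
  ∑ φ []       = 0#
  ∑ φ (x ∷ xs) = φ x ⊞ ∑ φ xs

  private variable
    B C D : Set

  ∑-cong : {φ ψ : B → Carrier} → (∀ x → φ x ≋ ψ x) → ∀ xs → ∑ φ xs ≋ ∑ ψ xs
  ∑-cong φ≋ψ []       = K.refl
  ∑-cong φ≋ψ (x ∷ xs) = K.+-cong (φ≋ψ x) (∑-cong φ≋ψ xs)

  ∑-map-++ : (φ : C → Carrier) (g : B → C) (xs : List B) (ys : List C) →
             ∑ φ (map g xs ++ ys) ≋ ∑ (λ x → φ (g x)) xs ⊞ ∑ φ ys
  ∑-map-++ φ g []       ys = K.sym (K.+-identityˡ _)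
  ∑-map-++ φ g (x ∷ xs) ys =
    K.trans (K.+-congˡ (∑-map-++ φ g xs ys)) (K.sym (K.+-assoc _ _ _))

  ∑-+ : (φ ψ : B → Carrier) (xs : List B) → ∑ (λ x → φ x ⊞ ψ x) xs ≋ ∑ φ xs ⊞ ∑ ψ xs
  ∑-+ φ ψ []       = K.sym (K.+-identityˡ _)
  ∑-+ φ ψ (x ∷ xs) = K.trans (K.+-congˡ (∑-+ φ ψ xs)) (interchange _ _ _ _)

  ∑-*ˡ : (c : Carrier) (φ : B → Carrier) (xs : List B) → ∑ (λ x → c ⊠ φ x) xs ≋ c ⊠ ∑ φ xs
  ∑-*ˡ c φ []       = K.sym (K.zeroʳ c)
  ∑-*ˡ c φ (x ∷ xs) = K.trans (K.+-congˡ (∑-*ˡ c φ xs)) (K.sym (K.distribˡ c _ _))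

  ∑-*ʳ : (c : Carrier) (φ : B → Carrier) (xs : List B) → ∑ (λ x → φ x ⊠ c) xs ≋ ∑ φ xs ⊠ c
  ∑-*ʳ c φ []       = K.sym (K.zeroˡ c)
  ∑-*ʳ c φ (x ∷ xs) = K.trans (K.+-congˡ (∑-*ʳ c φ xs)) (K.sym (K.distribʳ c _ _))

  ∑-cartesianProduct : (φ : D → Carrier) (f : B → C → D) (xs : List B) (ys : List C) →
    ∑ φ (cartesianProductWith f xs ys) ≋ ∑ (λ x → ∑ (λ y → φ (f x y)) ys) xs
  ∑-cartesianProduct φ f []       ys = K.refl
  ∑-cartesianProduct φ f (x ∷ xs) ys =
    K.trans (∑-map-++ φ (f x) ys _) (K.+-congˡ (∑-cartesianProduct φ f xs ys))

  private
    ∑∑-* : (α : B → Carrier) (β : C → Carrier) (xs : List B) (ys : List C) →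
           ∑ (λ x → ∑ (λ y → α x ⊠ β y) ys) xs ≋ ∑ α xs ⊠ ∑ β ys
    ∑∑-* α β xs ys =
      K.trans (∑-cong (λ x → ∑-*ˡ (α x) β ys) xs) (∑-*ʳ (∑ β ys) α xs)

  module _ {φ : D → Carrier} {f : B → C → D} (xs : List B) (ys : List C) where

    ∑-product : {α : B → Carrier} {β : C → Carrier} →
      (∀ x y → φ (f x y) ≋ α x ⊠ β y) →
      ∑ φ (cartesianProductWith f xs ys) ≋ ∑ α xs ⊠ ∑ β ys
    ∑-product {α} {β} eq = begin
      ∑ φ (cartesianProductWith f xs ys)       ≈⟨ ∑-cartesianProduct φ f xs ys ⟩
      ∑ (λ x → ∑ (λ y → φ (f x y)) ys) xs      ≈⟨ ∑-cong (λ x → ∑-cong (eq x) ys) xs ⟩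
      ∑ (λ x → ∑ (λ y → α x ⊠ β y) ys) xs      ≈⟨ ∑∑-* α β xs ys ⟩
      ∑ α xs ⊠ ∑ β ys                          ∎

    -- A product rule, with `α′` and `β′` in the role of the derivatives of `α` and `β`.
    ∑-leibniz : {α α′ : B → Carrier} {β β′ : C → Carrier} →
      (∀ x y → φ (f x y) ≋ α′ x ⊠ β y ⊞ α x ⊠ β′ y) →
      ∑ φ (cartesianProductWith f xs ys) ≋ ∑ α′ xs ⊠ ∑ β ys ⊞ ∑ α xs ⊠ ∑ β′ ys
    ∑-leibniz {α} {α′} {β} {β′} eq = begin
      ∑ φ (cartesianProductWith f xs ys)
        ≈⟨ ∑-cartesianProduct φ f xs ys ⟩
      ∑ (λ x → ∑ (λ y → φ (f x y)) ys) xs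
        ≈⟨ ∑-cong (λ x → K.trans (∑-cong (eq x) ys) (∑-+ _ _ ys)) xs ⟩
      ∑ (λ x → ∑ (λ y → α′ x ⊠ β y) ys ⊞ ∑ (λ y → α x ⊠ β′ y) ys) xs
        ≈⟨ ∑-+ _ _ xs ⟩
      ∑ (λ x → ∑ (λ y → α′ x ⊠ β y) ys) xs ⊞ ∑ (λ x → ∑ (λ y → α x ⊠ β′ y) ys) xs
        ≈⟨ K.+-cong (∑∑-* α′ β xs ys) (∑∑-* α β′ xs ys) ⟩
      ∑ α′ xs ⊠ ∑ β ys ⊞ ∑ α xs ⊠ ∑ β′ ys ∎

-- The commutative ring of formal power series.

tail : PowerSeries → PowerSeries
tail A n = A (suc n)

scalar : ℚ → PowerSeries
scalar q zero    = q
scalar q (suc _) = 0ℚ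

⊝_ : PowerSeries → PowerSeries
(⊝ A) n = - A n

-- This is congruence modulo `x^(n+1)`.
_≈[_]_ : PowerSeries → ℕ → PowerSeries → Set
A ≈[ n ] B = ∀ {i} → i ≤ n → A i ≡ B i

-- A coefficient of a product involves only coefficients of the factors of at most the same index.
-- This compatibility with truncation later carries the recurrences in the depth over to the
-- diagonal series.
⊗-cong-≤ : ∀ {n A A′ B B′} → A ≈[ n ] A′ → B ≈[ n ] B′ → (A ⊗ B) ≈[ n ] (A′ ⊗ B′)
⊗-cong-≤ A≈A′ B≈B′ {m} m≤n = sum-cong-≗ {suc m} λ i → cong₂ _*_
  (A≈A′ (ℕₚ.≤-trans (Finₚ.toℕ≤pred[n] i) m≤n))
  (B≈B′ (ℕₚ.≤-trans (ℕₚ.m∸n≤m m (toℕ i)) m≤n))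

⊗-cong : ∀ {A A′ B B′} → A ≈ A′ → B ≈ B′ → A ⊗ B ≈ A′ ⊗ B′
⊗-cong A≈A′ B≈B′ n = ⊗-cong-≤ (λ {i} _ → A≈A′ i) (λ {i} _ → B≈B′ i) ℕₚ.≤-refl

open +-*-Solver using (solve; con; _:+_; _:*_; _:=_)

-- In the following inductions (A ⊗ B) (suc n) unfolds to
-- A 0 * B (suc n) + (tail A ⊗ B) n.

⊗-distribʳ : ∀ C A B → (A ⊕ B) ⊗ C ≈ A ⊗ C ⊕ B ⊗ C
⊗-distribʳ C A B zero    =
  solve 3 (λ a b c → (a :+ b) :* c :+ con 0ℚ := a :* c :+ con 0ℚ :+ (b :* c :+ con 0ℚ))
    refl (A 0) (B 0) (C 0)
⊗-distribʳ C A B (suc n) =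
  trans (cong ((A 0 + B 0) * C (suc n) +_) (⊗-distribʳ C (tail A) (tail B) n))
    (solve 5 (λ a b c p q → (a :+ b) :* c :+ (p :+ q) := a :* c :+ p :+ (b :* c :+ q))
      refl (A 0) (B 0) (C (suc n)) _ _)

⊗-scaleˡ : ∀ q A B n → ((λ i → q * A i) ⊗ B) n ≡ q * (A ⊗ B) n
⊗-scaleˡ q A B zero    =
  solve 3 (λ q a b → q :* a :* b :+ con 0ℚ := q :* (a :* b :+ con 0ℚ)) refl q (A 0) (B 0)
⊗-scaleˡ q A B (suc n) =
  trans (cong (q * A 0 * B (suc n) +_) (⊗-scaleˡ q (tail A) B n))
    (solve 4 (λ q a b p → q :* a :* b :+ q :* p := q :* (a :* b :+ p))
      refl q (A 0) (B (suc n)) _)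

⊗-assoc : ∀ A B C → (A ⊗ B) ⊗ C ≈ A ⊗ (B ⊗ C)
⊗-assoc A B C zero    =
  solve 3 (λ a b c → (a :* b :+ con 0ℚ) :* c :+ con 0ℚ := a :* (b :* c :+ con 0ℚ) :+ con 0ℚ)
    refl (A 0) (B 0) (C 0)
⊗-assoc A B C (suc n) = begin
  (A 0 * B 0 + 0ℚ) * C (suc n) + (tail (A ⊗ B) ⊗ C) n
    ≡⟨ cong ((A 0 * B 0 + 0ℚ) * C (suc n) +_)
         (trans (⊗-distribʳ C (λ i → A 0 * B (suc i)) (tail A ⊗ B) n)
                (cong₂ _+_ (⊗-scaleˡ (A 0) (tail B) C n) (⊗-assoc (tail A) B C n))) ⟩
  (A 0 * B 0 + 0ℚ) * C (suc n) + (A 0 * (tail B ⊗ C) n + (tail A ⊗ (B ⊗ C)) n)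
    ≡⟨ solve 5 (λ a b c p q → (a :* b :+ con 0ℚ) :* c :+ (a :* p :+ q) := a :* (b :* c :+ p) :+ q)
         refl (A 0) (B 0) (C (suc n)) _ _ ⟩
  A 0 * (B 0 * C (suc n) + (tail B ⊗ C) n) + (tail A ⊗ (B ⊗ C)) n ∎
  where open ≡-Reasoning

-- The convolution unfolds by its first summand; here the last one is split off instead.
-- Commutativity exchanges the two expansions.
⊗-suc : ∀ A B n → (A ⊗ B) (suc n) ≡ (A ⊗ tail B) n + A (suc n) * B 0
⊗-suc A B zero    =
  solve 2 (λ p q → p :+ (q :+ con 0ℚ) := p :+ con 0ℚ :+ q) refl (A 0 * B 1) (A 1 * B 0)
⊗-suc A B (suc n) =
  trans (cong (A 0 * B (suc (suc n)) +_) (⊗-suc (tail A) B n))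
    (sym (ℚₚ.+-assoc (A 0 * B (suc (suc n))) ((tail A ⊗ tail B) n) _))

⊗-comm : ∀ A B → A ⊗ B ≈ B ⊗ A
⊗-comm A B zero    = cong (_+ 0ℚ) (ℚₚ.*-comm (A 0) (B 0))
⊗-comm A B (suc n) = begin
  A 0 * B (suc n) + (tail A ⊗ B) n ≡⟨ cong₂ _+_ (ℚₚ.*-comm (A 0) _) (⊗-comm (tail A) B n) ⟩
  B (suc n) * A 0 + (B ⊗ tail A) n ≡⟨ ℚₚ.+-comm _ ((B ⊗ tail A) n) ⟩
  (B ⊗ tail A) n + B (suc n) * A 0 ≡⟨ ⊗-suc B A n ⟨
  (B ⊗ A) (suc n)                  ∎
  where open ≡-Reasoning

⊗-zeroˡ : ∀ A n → ((λ _ → 0ℚ) ⊗ A) n ≡ 0ℚ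
⊗-zeroˡ A n = trans (⊗-scaleˡ 0ℚ (λ _ → 0ℚ) A n) (ℚₚ.*-zeroˡ (((λ _ → 0ℚ) ⊗ A) n))

scalar-⊗ : ∀ q A n → (scalar q ⊗ A) n ≡ q * A n
scalar-⊗ q A zero    = ℚₚ.+-identityʳ (q * A 0)
scalar-⊗ q A (suc n) = trans (cong (q * A (suc n) +_) (⊗-zeroˡ A n)) (ℚₚ.+-identityʳ _)

⊗-identityˡ : ∀ A → scalar 1ℚ ⊗ A ≈ A
⊗-identityˡ A n = trans (scalar-⊗ 1ℚ A n) (ℚₚ.*-identityˡ (A n))

⊗-distribˡ : ∀ C A B → C ⊗ (A ⊕ B) ≈ C ⊗ A ⊕ C ⊗ B
⊗-distribˡ C A B n = begin
  (C ⊗ (A ⊕ B)) n       ≡⟨ ⊗-comm C (A ⊕ B) n ⟩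
  ((A ⊕ B) ⊗ C) n       ≡⟨ ⊗-distribʳ C A B n ⟩
  (A ⊗ C) n + (B ⊗ C) n ≡⟨ cong₂ _+_ (⊗-comm A C n) (⊗-comm B C n) ⟩
  (C ⊗ A) n + (C ⊗ B) n ∎
  where open ≡-Reasoning

⊕-⊗-commutativeRing : CommutativeRing 0ℓ 0ℓ
⊕-⊗-commutativeRing = record
  { Carrier = PowerSeries
  ; _≈_     = _≈_
  ; _+_     = _⊕_
  ; _*_     = _⊗_
  ; -_      = ⊝_
  ; 0#      = λ _ → 0ℚ
  ; 1#      = scalar 1ℚ
  ; isCommutativeRing = record
    { isRing = record
      { +-isAbelianGroup = record
        { isGroup = record
          { isMonoid = record
            { isSemigroup = record
              { isMagma = record
                { isEquivalence = record
                  { refl  = λ _ → refl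
                  ; sym   = λ p n → sym (p n)
                  ; trans = λ p q n → trans (p n) (q n)
                  }
                ; ∙-cong = λ p q n → cong₂ _+_ (p n) (q n)
                }
              ; assoc = λ A B C n → ℚₚ.+-assoc (A n) (B n) (C n)
              }
            ; identity = (λ A n → ℚₚ.+-identityˡ (A n)) , (λ A n → ℚₚ.+-identityʳ (A n))
            }
          ; inverse = (λ A n → ℚₚ.+-inverseˡ (A n)) , (λ A n → ℚₚ.+-inverseʳ (A n))
          ; ⁻¹-cong = λ p n → cong -_ (p n)
          }
        ; comm = λ A B n → ℚₚ.+-comm (A n) (B n)
        }
      ; *-cong     = ⊗-cong
      ; *-assoc    = ⊗-assoc
      ; *-identity = ⊗-identityˡ , (λ A n → trans (⊗-comm A (scalar 1ℚ) n) (⊗-identityˡ A n))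
      ; distrib    = ⊗-distribˡ , ⊗-distribʳ
      }
    ; *-comm = ⊗-comm
    }
  }

scalar-homomorphism : CommutativeRing.rawRing ℚₚ.+-*-commutativeRing
                        -Raw-AlmostCommutative⟶ fromCommutativeRing ⊕-⊗-commutativeRing
scalar-homomorphism = record
  { ⟦_⟧    = scalar
  ; +-homo = λ p q → λ { zero → refl ; (suc _) → refl }
  ; *-homo = λ p q n → sym (trans (scalar-⊗ p (scalar q) n) (scale p q n))
  ; -‿homo = λ p → λ { zero → refl ; (suc _) → refl }
  ; 0-homo = λ { zero → refl ; (suc _) → refl }
  ; 1-homo = λ _ → refl
  }
  where
  scale : ∀ p q n → p * scalar q n ≡ scalar (p * q) n
  scale p q zero    = refl
  scale p q (suc n) = ℚₚ.*-zeroʳ p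

-- The division in `ℕ→ℚ` normalises its fraction and does not reduce for a variable argument. Over
-- unnormalised rationals with denominator 1 the claim is an identity of integers.
ℕ→ℚ-+ : ∀ m n → ℕ→ℚ (m ℕ.+ n) ≡ ℕ→ℚ m + ℕ→ℚ n
ℕ→ℚ-+ m n = ℚₚ.toℚᵘ-injective (begin
  toℚᵘ (ℕ→ℚ (m ℕ.+ n))              ≈⟨ ℚₚ.toℚᵘ-fromℚᵘ (integer (m ℕ.+ n)) ⟩
  integer (m ℕ.+ n)                 ≈⟨ ℚᵘ.*≡* (cong (ℤ._* ℤ.1ℤ) numerators) ⟩
  integer m ℚᵘ.+ integer n          ≈⟨ ℚᵘₚ.+-cong (ℚₚ.toℚᵘ-fromℚᵘ (integer m))
                                                    (ℚₚ.toℚᵘ-fromℚᵘ (integer n)) ⟨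
  toℚᵘ (ℕ→ℚ m) ℚᵘ.+ toℚᵘ (ℕ→ℚ n)    ≈⟨ ℚₚ.toℚᵘ-homo-+ (ℕ→ℚ m) (ℕ→ℚ n) ⟨
  toℚᵘ (ℕ→ℚ m + ℕ→ℚ n)              ∎)
  where
  open ℚᵘₚ.≃-Reasoning
  integer : ℕ → ℚᵘ.ℚᵘ
  integer k = ℚᵘ.mkℚᵘ (ℤ.+ k) 0
  numerators : ℤ.+ (m ℕ.+ n) ≡ ℤ.+ m ℤ.* ℤ.1ℤ ℤ.+ ℤ.+ n ℤ.* ℤ.1ℤ
  numerators = trans (ℤₚ.pos-+ m n)
    (sym (cong₂ ℤ._+_ (ℤₚ.*-identityʳ (ℤ.+ m)) (ℤₚ.*-identityʳ (ℤ.+ n))))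

-- Weighted generating functions of lists.

private module PS = CommutativeRing ⊕-⊗-commutativeRing
open ListSum PS.semiring

-- The monomial `w x^n`; recursion on the exponent matches the unfolding of `_⊗_` along `tail`.
term : ℕ → ℕ → PowerSeries
term w zero            = scalar (ℕ→ℚ w)
term w (suc n) zero    = 0ℚ
term w (suc n) (suc i) = term w n i

term-diagonal : ∀ w n → term w n n ≡ ℕ→ℚ w
term-diagonal w zero    = refl
term-diagonal w (suc n) = term-diagonal w n

term-off-diagonal : ∀ w n i → n ≢ i → term w n i ≡ 0ℚ
term-off-diagonal w zero    zero    n≢i = contradiction refl n≢i
term-off-diagonal w zero    (suc i) n≢i = refl
term-off-diagonal w (suc n) zero    n≢i = refl
term-off-diagonal w (suc n) (suc i) n≢i = term-off-diagonal w n i (n≢i ∘ cong suc)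

term-0 : ∀ n i → term 0 n i ≡ 0ℚ
term-0 zero    zero    = refl
term-0 zero    (suc i) = refl
term-0 (suc n) zero    = refl
term-0 (suc n) (suc i) = term-0 n i

term-+ : ∀ v w n → term (v ℕ.+ w) n ≈ term v n ⊕ term w n
term-+ v w zero    zero    = ℕ→ℚ-+ v w
term-+ v w zero    (suc i) = refl
term-+ v w (suc n) zero    = refl
term-+ v w (suc n) (suc i) = term-+ v w n i

-- One factor has weight 1 because in every product below at most one factor carries the marked
-- vertex.
term-⊗-term₁ : ∀ w m n → term w m ⊗ term 1 n ≈ term w (m ℕ.+ n)
term-⊗-term₁ w zero n i = trans (scalar-⊗ (ℕ→ℚ w) (term 1 n) i) (scale n i)
  where
  scale : ∀ n i → ℕ→ℚ w * term 1 n i ≡ term w n i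
  scale zero    zero    = ℚₚ.*-identityʳ (ℕ→ℚ w)
  scale zero    (suc i) = ℚₚ.*-zeroʳ (ℕ→ℚ w)
  scale (suc n) zero    = ℚₚ.*-zeroʳ (ℕ→ℚ w)
  scale (suc n) (suc i) = scale n i
term-⊗-term₁ w (suc m) n zero    = cong (_+ 0ℚ) (ℚₚ.*-zeroˡ (term 1 n 0))
term-⊗-term₁ w (suc m) n (suc i) =
  trans (cong₂ _+_ (ℚₚ.*-zeroˡ (term 1 n (suc i))) (term-⊗-term₁ w m n i))
        (ℚₚ.+-identityˡ (term w (m ℕ.+ n) i))

term₁-⊗-term : ∀ w m n → term 1 m ⊗ term w n ≈ term w (m ℕ.+ n)
term₁-⊗-term w m n i = begin
  (term 1 m ⊗ term w n) i ≡⟨ ⊗-comm (term 1 m) (term w n) i ⟩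
  (term w n ⊗ term 1 m) i ≡⟨ term-⊗-term₁ w n m i ⟩
  term w (n ℕ.+ m) i      ≡⟨ cong (λ j → term w j i) (ℕₚ.+-comm n m) ⟩
  term w (m ℕ.+ n) i      ∎
  where open ≡-Reasoning

private variable
  B C D : Set

1′ : B → ℕ
1′ _ = 1

genFun : (w ℓ : B → ℕ) → List B → PowerSeries
genFun w ℓ = ∑ (λ x → term (w x) (ℓ x))

genFun-product :
  (f : B → C → D) (ℓ₁ : B → ℕ) (ℓ₂ : C → ℕ) (ℓ : D → ℕ) →
  (∀ x y → ℓ (f x y) ≡ ℓ₁ x ℕ.+ ℓ₂ y) → ∀ xs ys →
  genFun 1′ ℓ (cartesianProductWith f xs ys) ≈ genFun 1′ ℓ₁ xs ⊗ genFun 1′ ℓ₂ ys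
genFun-product f ℓ₁ ℓ₂ ℓ ℓ-eq xs ys =
  ∑-product {f = f} xs ys λ x y i → begin
    term 1 (ℓ (f x y)) i             ≡⟨ cong (λ j → term 1 j i) (ℓ-eq x y) ⟩
    term 1 (ℓ₁ x ℕ.+ ℓ₂ y) i         ≡⟨ term-⊗-term₁ 1 (ℓ₁ x) (ℓ₂ y) i ⟨
    (term 1 (ℓ₁ x) ⊗ term 1 (ℓ₂ y)) i ∎
  where open ≡-Reasoning

-- If the weight counts the ways to mark an object, then additivity says that a mark on `f x y` lies
-- either in `x` or in `y`. The unmarked component is then merely counted, with weight `1′`.
genFun-leibniz :
  (f : B → C → D) (w₁ ℓ₁ : B → ℕ) (w₂ ℓ₂ : C → ℕ) (w ℓ : D → ℕ) →
  (∀ x y → w (f x y) ≡ w₁ x ℕ.+ w₂ y) → (∀ x y → ℓ (f x y) ≡ ℓ₁ x ℕ.+ ℓ₂ y) → ∀ xs ys →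
  genFun w ℓ (cartesianProductWith f xs ys) ≈
    genFun w₁ ℓ₁ xs ⊗ genFun 1′ ℓ₂ ys ⊕ genFun 1′ ℓ₁ xs ⊗ genFun w₂ ℓ₂ ys
genFun-leibniz f w₁ ℓ₁ w₂ ℓ₂ w ℓ w-eq ℓ-eq xs ys =
  ∑-leibniz {f = f} xs ys λ x y i → begin
    term (w (f x y)) (ℓ (f x y)) i
      ≡⟨ cong₂ (λ u j → term u j i) (w-eq x y) (ℓ-eq x y) ⟩
    term (w₁ x ℕ.+ w₂ y) (ℓ₁ x ℕ.+ ℓ₂ y) i
      ≡⟨ term-+ (w₁ x) (w₂ y) (ℓ₁ x ℕ.+ ℓ₂ y) i ⟩
    term (w₁ x) (ℓ₁ x ℕ.+ ℓ₂ y) i + term (w₂ y) (ℓ₁ x ℕ.+ ℓ₂ y) i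
      ≡⟨ cong₂ _+_ (term-⊗-term₁ (w₁ x) (ℓ₁ x) (ℓ₂ y) i)
                   (term₁-⊗-term (w₂ y) (ℓ₁ x) (ℓ₂ y) i) ⟨
    (term (w₁ x) (ℓ₁ x) ⊗ term 1 (ℓ₂ y)) i + (term 1 (ℓ₁ x) ⊗ term (w₂ y) (ℓ₂ y)) i ∎
  where open ≡-Reasoning

genFun-coefficient : ∀ (w ℓ : B → ℕ) n xs →
  genFun w ℓ xs n ≡ ℕ→ℚ (sum (map w (filter (λ x → ℓ x ℕₚ.≟ n) xs)))
genFun-coefficient w ℓ n []       = refl
genFun-coefficient w ℓ n (x ∷ xs) with ℓ x ℕₚ.≟ n
... | yes refl = begin
  term (w x) n n + genFun w ℓ xs n
    ≡⟨ cong₂ _+_ (term-diagonal (w x) n) (genFun-coefficient w ℓ n xs) ⟩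
  ℕ→ℚ (w x) + ℕ→ℚ (sum (map w (filter ℓ≟n xs)))
    ≡⟨ ℕ→ℚ-+ (w x) _ ⟨
  ℕ→ℚ (sum (map w (x ∷ filter ℓ≟n xs)))
    ≡⟨ cong (ℕ→ℚ ∘ sum ∘ map w) (Listₚ.filter-accept ℓ≟n refl) ⟨
  ℕ→ℚ (sum (map w (filter ℓ≟n (x ∷ xs)))) ∎
  where
  open ≡-Reasoning
  ℓ≟n = λ y → ℓ y ℕₚ.≟ n
... | no ℓx≢n = begin
  term (w x) (ℓ x) n + genFun w ℓ xs n
    ≡⟨ cong₂ _+_ (term-off-diagonal (w x) (ℓ x) n ℓx≢n) (genFun-coefficient w ℓ n xs) ⟩
  0ℚ + ℕ→ℚ (sum (map w (filter ℓ≟n xs)))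
    ≡⟨ ℚₚ.+-identityˡ _ ⟩
  ℕ→ℚ (sum (map w (filter ℓ≟n xs)))
    ≡⟨ cong (ℕ→ℚ ∘ sum ∘ map w) (Listₚ.filter-reject ℓ≟n ℓx≢n) ⟨
  ℕ→ℚ (sum (map w (filter ℓ≟n (x ∷ xs)))) ∎
  where
  open ≡-Reasoning
  ℓ≟n = λ y → ℓ y ℕₚ.≟ n

-- Only entries with `ℓ x ≡ n` contribute to the coefficient. Filtering for them leaves two
-- duplicate-free lists with the same elements, hence permutations of each other, and a sum is
-- invariant under permutation.
genFun-stable : ∀ (w ℓ : B → ℕ) {n xs ys} → Unique xs → Unique ys →
  (∀ {x} → ℓ x ≡ n → x ∈ xs) → (∀ {x} → ℓ x ≡ n → x ∈ ys) →
  genFun w ℓ xs n ≡ genFun w ℓ ys n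
genFun-stable w ℓ {n} {xs} {ys} xs! ys! xs-complete ys-complete = begin
  genFun w ℓ xs n                      ≡⟨ genFun-coefficient w ℓ n xs ⟩
  ℕ→ℚ (sum (map w (filter ℓ≟n xs)))    ≡⟨ cong ℕ→ℚ (sum-↭ (map⁺ w (∼bag⇒↭
    (unique∧set⇒bag (filter⁺ ℓ≟n xs!) (filter⁺ ℓ≟n ys!)
      (mk⇔ (transfer xs ys-complete) (transfer ys xs-complete)))))) ⟩
  ℕ→ℚ (sum (map w (filter ℓ≟n ys)))    ≡⟨ genFun-coefficient w ℓ n ys ⟨
  genFun w ℓ ys n                      ∎
  where
  open ≡-Reasoning
  ℓ≟n = λ y → ℓ y ℕₚ.≟ n
  transfer : ∀ us {vs} → (∀ {x} → ℓ x ≡ n → x ∈ vs) →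
             ∀ {x} → x ∈ filter ℓ≟n us → x ∈ filter ℓ≟n vs
  transfer us vs-complete x∈ =
    let ℓx≡n = proj₂ (∈-filter⁻ ℓ≟n {xs = us} x∈) in ∈-filter⁺ ℓ≟n (vs-complete ℓx≡n) ℓx≡n

-- Series without a depth bound.

-- As the n-th coefficient is the same for all d ≥ n, the series of a fixed
-- depth bound d may be replaced by the diagonal one.

treeSeries : (Tree → ℕ) → PowerSeries
treeSeries w n = genFun w leaves (boundedTrees n) n

forestSeries : (List Tree → ℕ) → PowerSeries
-- The bound is `suc n` because nesting a list costs one more level: `boundedForests 0` is empty, so
-- even the forest without leaves first occurs at bound 1.
forestSeries w n = genFun w leaves* (boundedForests (suc n)) n

treeSeries-limit : ∀ w d → treeSeries w ≈[ d ] genFun w leaves (boundedTrees d)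
treeSeries-limit w d {i} i≤d = genFun-stable w leaves
  (boundedTrees-unique i) (boundedTrees-unique d)
  (λ {t} p → boundedTrees-complete t i (ℕₚ.≤-reflexive p))
  (λ {t} p → boundedTrees-complete t d (ℕₚ.≤-trans (ℕₚ.≤-reflexive p) i≤d))

forestSeries-limit : ∀ w d → forestSeries w ≈[ d ] genFun w leaves* (boundedForests (suc d))
forestSeries-limit w d {i} i≤d = genFun-stable w leaves*
  (boundedForests-unique (suc i)) (boundedForests-unique (suc d))
  (λ {ts} p → boundedForests-complete ts (suc i) (s≤s (ℕₚ.≤-reflexive p)))
  (λ {ts} p → boundedForests-complete ts (suc d) (s≤s (ℕₚ.≤-trans (ℕₚ.≤-reflexive p) i≤d)))

-- Leaf and vertex counts under decomposition at the root.

pairLeaves : Tree × List Tree → ℕ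
pairLeaves (u , us) = leaves u ℕ.+ leaves* us

nodeWith-leaves : ∀ t p → leaves (nodeWith t p) ≡ leaves t ℕ.+ pairLeaves p
nodeWith-leaves t (u , us) = ℕₚ.+-assoc (leaves t) (leaves u) (leaves* us)

count : ℕ → List Tree → ℕ
count k ts = length (filter (λ s → size s ℕₚ.≟ k) ts)

count-++ : ∀ k ts us → count k (ts ++ us) ≡ count k ts ℕ.+ count k us
count-++ k ts us = trans (cong length (Listₚ.filter-++ _ ts us))
                         (Listₚ.length-++ (filter (λ s → size s ℕₚ.≟ k) ts))

-- `subtrees t` lists `t` itself first, so dropping one entry removes exactly the root. Writing the
-- indicator of the root as a `count` over a singleton lets `count-++` produce the split.
rootOfSize #properVertices : ℕ → Tree → ℕ
rootOfSize      k t = count k (t ∷ [])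
#properVertices k t = count k (drop 1 (subtrees t))

#verticesOfSize* : ℕ → List Tree → ℕ
#verticesOfSize* k ts = count k (subtrees* ts)

pairVertices : ℕ → Tree × List Tree → ℕ
pairVertices k (u , us) = #verticesOfSize k u ℕ.+ #verticesOfSize* k us

#verticesOfSize-split : ∀ k t → #verticesOfSize k t ≡ rootOfSize k t ℕ.+ #properVertices k t
#verticesOfSize-split k t@leaf          = count-++ k (t ∷ []) []
#verticesOfSize-split k t@(node _ _ _) = count-++ k (t ∷ []) (drop 1 (subtrees t))

nodeWith-properVertices : ∀ k t p →
  #properVertices k (nodeWith t p) ≡ #verticesOfSize k t ℕ.+ pairVertices k p
nodeWith-properVertices k t (u , us) =
  trans (count-++ k (subtrees t) (subtrees u ++ subtrees* us))
        (cong (#verticesOfSize k t ℕ.+_) (count-++ k (subtrees u) (subtrees* us)))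

A L : PowerSeries
A = treeSeries 1′
L = forestSeries 1′

X-term : term 1 1 ≈ X
X-term 0             = refl
X-term 1             = refl
X-term (suc (suc n)) = refl

-- Recurrences in the depth bound.

module BoundedDepth (d : ℕ) where
  trees : List Tree
  trees = boundedTrees d

  forests : List (List Tree)
  forests = boundedForests d

  -- A node is built from its first child and such a pair, so the rules for binary products apply
  -- twice, with pairs as the intermediate objects.
  pairs : List (Tree × List Tree)
  pairs = cartesianProductWith _,_ trees forests

  a l : PowerSeries
  a = genFun 1′ leaves trees
  l = genFun 1′ leaves* forests

  pairs-genFun : genFun 1′ pairLeaves pairs ≈ a ⊗ l
  pairs-genFun = genFun-product _,_ leaves leaves* pairLeaves (λ _ _ → refl) trees forests

  trees-suc : genFun 1′ leaves (boundedTrees (suc d)) ≈ X ⊕ a ⊗ (a ⊗ l)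
  trees-suc = PS.+-cong {term 1 1} X-term (PS.trans
    (genFun-product nodeWith leaves pairLeaves leaves nodeWith-leaves trees pairs)
    (PS.*-congˡ {a} pairs-genFun))

  forests-suc : genFun 1′ leaves* (boundedForests (suc d)) ≈ scalar 1ℚ ⊕ a ⊗ l
  forests-suc = PS.+-congˡ {scalar 1ℚ}
    (genFun-product _∷_ leaves leaves* leaves* (λ _ _ → refl) trees forests)

  module Marked (k : ℕ) where
    τ f : PowerSeries
    τ = genFun (#verticesOfSize k) leaves trees
    f = genFun (#verticesOfSize* k) leaves* forests

    pairs-marked : genFun (pairVertices k) pairLeaves pairs ≈ τ ⊗ l ⊕ a ⊗ f
    pairs-marked = genFun-leibniz _,_ (#verticesOfSize k) leaves (#verticesOfSize* k) leaves*
      (pairVertices k) pairLeaves (λ _ _ → refl) (λ _ _ → refl) trees forests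

    marked-forests-suc : genFun (#verticesOfSize* k) leaves* (boundedForests (suc d))
                           ≈ τ ⊗ l ⊕ a ⊗ f
    marked-forests-suc = PS.trans
      -- The head entry `[]` has no vertex to mark and adds the zero series.
      (PS.+-cong {term 0 0} (term-0 0)
        (genFun-leibniz _∷_ (#verticesOfSize k) leaves (#verticesOfSize* k) leaves*
          (#verticesOfSize* k) leaves* (λ t ts → count-++ k (subtrees t) (subtrees* ts))
          (λ _ _ → refl) trees forests))
      (PS.+-identityˡ _)

    properly-marked-suc : genFun (#properVertices k) leaves (boundedTrees (suc d))
                            ≈ τ ⊗ (a ⊗ l) ⊕ a ⊗ (τ ⊗ l ⊕ a ⊗ f)
    properly-marked-suc = PS.trans
      -- The head entry `leaf` has no vertex below its root, so it too adds zero.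
      (PS.+-cong {term 0 1} (term-0 1)
        (PS.trans
          (genFun-leibniz nodeWith (#verticesOfSize k) leaves (pairVertices k) pairLeaves
            (#properVertices k) leaves (nodeWith-properVertices k) nodeWith-leaves trees pairs)
          (PS.+-cong {τ ⊗ genFun 1′ pairLeaves pairs}
            (PS.*-congˡ {τ} pairs-genFun) (PS.*-congˡ {a} pairs-marked))))
      (PS.+-identityˡ _)

    -- The marked vertex is the root or lies in a child. The root part stays unexpanded, since in
    -- the limit it becomes the series of trees of size `k`.
    marked-trees-suc : genFun (#verticesOfSize k) leaves (boundedTrees (suc d)) ≈
      genFun (rootOfSize k) leaves (boundedTrees (suc d))
        ⊕ (τ ⊗ (a ⊗ l) ⊕ a ⊗ (τ ⊗ l ⊕ a ⊗ f))
    marked-trees-suc = PS.trans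
      (∑-cong split (boundedTrees (suc d)))
      (PS.trans (∑-+ (λ t → term (rootOfSize k t) (leaves t)) _ (boundedTrees (suc d)))
        (PS.+-congˡ {genFun (rootOfSize k) leaves (boundedTrees (suc d))} properly-marked-suc))
      where
      split : ∀ t → term (#verticesOfSize k t) (leaves t) ≈
                    term (rootOfSize k t) (leaves t) ⊕ term (#properVertices k t) (leaves t)
      split t i = trans (cong (λ w → term w (leaves t) i) (#verticesOfSize-split k t))
                        (term-+ (rootOfSize k t) (#properVertices k t) (leaves t) i)

-- From recurrences to functional equations.

module Limit (n : ℕ) where
  -- At bound `suc n` every tree and every forest with at most `n` leaves is listed; one unfolding
  -- of the recurrence then lands at bound `2 + n`.
  open BoundedDepth (suc n) hiding (module Marked)
  open ≡-Reasoning

  trees-limit : ∀ w → treeSeries w ≈[ n ] genFun w leaves trees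
  trees-limit w i≤n = treeSeries-limit w (suc n) (ℕₚ.m≤n⇒m≤1+n i≤n)

  forests-limit : ∀ w → forestSeries w ≈[ n ] genFun w leaves* forests
  forests-limit w = forestSeries-limit w n

  A⊗L-limit : (A ⊗ L) ≈[ n ] (a ⊗ l)
  A⊗L-limit = ⊗-cong-≤ (trees-limit 1′) (forests-limit 1′)

  -- Up to index `n` the diagonal series agree with those at bounds `suc n` and `2 + n`, so both
  -- sides of the recurrence may be replaced by the same unbounded series. The other three equations
  -- are obtained in the same way.
  A-equation : A n ≡ (X ⊕ A ⊗ (A ⊗ L)) n
  A-equation = begin
    A n
      ≡⟨ treeSeries-limit 1′ (2 ℕ.+ n) (ℕₚ.m≤n+m n 2) ⟩
    genFun 1′ leaves (boundedTrees (2 ℕ.+ n)) n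
      ≡⟨ trees-suc n ⟩
    X n + (a ⊗ (a ⊗ l)) n
      ≡⟨ cong (X n +_) (⊗-cong-≤ (trees-limit 1′) A⊗L-limit ℕₚ.≤-refl) ⟨
    X n + (A ⊗ (A ⊗ L)) n ∎

  L-equation : L n ≡ (scalar 1ℚ ⊕ A ⊗ L) n
  L-equation = begin
    L n
      ≡⟨ forestSeries-limit 1′ (suc n) (ℕₚ.n≤1+n n) ⟩
    genFun 1′ leaves* (boundedForests (2 ℕ.+ n)) n
      ≡⟨ forests-suc n ⟩
    scalar 1ℚ n + (a ⊗ l) n
      ≡⟨ cong (scalar 1ℚ n +_) (A⊗L-limit ℕₚ.≤-refl) ⟨
    scalar 1ℚ n + (A ⊗ L) n ∎

  module Marked (k : ℕ) where
    open BoundedDepth.Marked (suc n) k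

    V P F : PowerSeries
    V = treeSeries (#verticesOfSize k)
    P = treeSeries (rootOfSize k)
    F = forestSeries (#verticesOfSize* k)

    V⊗L⊕A⊗F-limit : (V ⊗ L ⊕ A ⊗ F) ≈[ n ] (τ ⊗ l ⊕ a ⊗ f)
    V⊗L⊕A⊗F-limit i≤n = cong₂ _+_
      (⊗-cong-≤ (trees-limit (#verticesOfSize k)) (forests-limit 1′) i≤n)
      (⊗-cong-≤ (trees-limit 1′) (forests-limit (#verticesOfSize* k)) i≤n)

    V-equation : V n ≡ (P ⊕ (V ⊗ (A ⊗ L) ⊕ A ⊗ (V ⊗ L ⊕ A ⊗ F))) n
    V-equation = begin
      V n
        ≡⟨ treeSeries-limit (#verticesOfSize k) (2 ℕ.+ n) (ℕₚ.m≤n+m n 2) ⟩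
      genFun (#verticesOfSize k) leaves (boundedTrees (2 ℕ.+ n)) n
        ≡⟨ marked-trees-suc n ⟩
      genFun (rootOfSize k) leaves (boundedTrees (2 ℕ.+ n)) n
        + ((τ ⊗ (a ⊗ l)) n + (a ⊗ (τ ⊗ l ⊕ a ⊗ f)) n)
        ≡⟨ cong₂ _+_ (treeSeries-limit (rootOfSize k) (2 ℕ.+ n) (ℕₚ.m≤n+m n 2)) (cong₂ _+_
             (⊗-cong-≤ (trees-limit (#verticesOfSize k)) A⊗L-limit ℕₚ.≤-refl)
             (⊗-cong-≤ (trees-limit 1′) V⊗L⊕A⊗F-limit ℕₚ.≤-refl)) ⟨
      P n + ((V ⊗ (A ⊗ L)) n + (A ⊗ (V ⊗ L ⊕ A ⊗ F)) n) ∎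

    F-equation : F n ≡ (V ⊗ L ⊕ A ⊗ F) n
    F-equation = begin
      F n
        ≡⟨ forestSeries-limit (#verticesOfSize* k) (suc n) (ℕₚ.n≤1+n n) ⟩
      genFun (#verticesOfSize* k) leaves* (boundedForests (2 ℕ.+ n)) n
        ≡⟨ marked-forests-suc n ⟩
      (τ ⊗ l ⊕ a ⊗ f) n
        ≡⟨ V⊗L⊕A⊗F-limit ℕₚ.≤-refl ⟨
      (V ⊗ L ⊕ A ⊗ F) n ∎

-- The series of the theorem and the square root.

T-series : ∀ k → T k ≈ treeSeries (#verticesOfSize k)
-- No tree has 0 leaves: `boundedTrees 0` is empty, in agreement with the value 0 fixed for `T k 0`.
T-series k zero    = refl
T-series k (suc n) =
  sym (genFun-coefficient (#verticesOfSize k) leaves (suc n) (boundedTrees (suc n)))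

-- `treeCount` is the length of a filtered list, whereas coefficients of `genFun` are sums of
-- weights; the indicator `rootOfSize k` mediates between them.
count≡sum : ∀ k ts → count k ts ≡ sum (map (rootOfSize k) ts)
count≡sum k []       = refl
count≡sum k (t ∷ ts) =
  trans (count-++ k (t ∷ []) ts) (cong (rootOfSize k t ℕ.+_) (count≡sum k ts))

R-series : ∀ k → R k ≈ treeSeries (rootOfSize k)
R-series k zero    = refl
R-series k (suc n) =
  trans (cong ℕ→ℚ (count≡sum k (Enumeration.list (treesWithLeaves (suc n)))))
        (sym (genFun-coefficient (rootOfSize k) leaves (suc n) (boundedTrees (suc n))))

const-scalar : ∀ c → const c ≈ scalar (ℕ→ℚ c)
const-scalar c zero    = refl
const-scalar c (suc n) = refl

open SchroederAlgebra ⊕-⊗-commutativeRing scalar-homomorphism using (#; S-square; V*4S)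

discriminant σ : PowerSeries
discriminant = const 1 ⊖ const 6 ⊗ X ⊕ X ⊗ X
σ = # 1 ⊕ X ⊖ # 4 ⊗ A

-- The constant term of `A` is 0, so that of `σ` computes to 1. This selects the square root
-- `√ discriminant` rather than its negative.
σ≈√ : σ ≈ √ discriminant
σ≈√ = √-unique discriminant σ refl (PS.trans
  (S-square {X} {A} {L} Limit.A-equation Limit.L-equation)
  (PS.+-congʳ {X ⊗ X} (PS.+-cong {# 1} (PS.sym (const-scalar 1))
    (PS.-‿cong (PS.*-congʳ {X} (PS.sym (const-scalar 6)))))))

lemma3p1 : ∀ (k : ℕ) → 1 ≤ k →
    let S = √ (const 1 ⊖ const 6 ⊗ X ⊕ X ⊗ X)
    in T k ≈ R k ⊗ ((const 3 ⊖ X ⊕ S) ⊘ (const 4 ⊗ S))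
lemma3p1 k _ = begin
  T k                                  ≈⟨ PS.*-identityʳ (T k) ⟨
  -- Inserting `4√ ⊗ 4√ ⁻¹` reduces the claim to the division-free identity `T⊗4√`.
  T k ⊗ scalar 1ℚ                      ≈⟨ PS.*-congˡ {T k} 4√⊗inverse ⟨
  T k ⊗ (4√ ⊗ 4√ ⁻¹)                   ≈⟨ PS.*-assoc (T k) 4√ (4√ ⁻¹) ⟨
  T k ⊗ 4√ ⊗ 4√ ⁻¹                     ≈⟨ PS.*-congʳ {4√ ⁻¹} T⊗4√ ⟩
  R k ⊗ numerator ⊗ 4√ ⁻¹              ≈⟨ PS.*-assoc (R k) numerator (4√ ⁻¹) ⟩
  R k ⊗ (numerator ⊘ 4√)               ∎
  where
  open import Relation.Binary.Reasoning.Setoid PS.setoid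
  4√ numerator : PowerSeries
  4√ = const 4 ⊗ √ discriminant
  numerator = const 3 ⊖ X ⊕ √ discriminant

  4√⊗inverse : 4√ ⊗ 4√ ⁻¹ ≈ scalar 1ℚ
  4√⊗inverse = PS.trans (⊗-comm 4√ (4√ ⁻¹)) (PS.trans (⁻¹-inverseˡ 4√) (const-scalar 1))

  T⊗4√ : T k ⊗ 4√ ≈ R k ⊗ numerator
  T⊗4√ = begin
    T k ⊗ 4√
      ≈⟨ PS.*-cong (T-series k) (PS.*-cong (const-scalar 4) (PS.sym σ≈√)) ⟩
    treeSeries (#verticesOfSize k) ⊗ (# 4 ⊗ σ)
      ≈⟨ V*4S {X} {A} {L} Limit.A-equation Limit.L-equation
           {treeSeries (rootOfSize k)} {treeSeries (#verticesOfSize k)}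
           {forestSeries (#verticesOfSize* k)}
           (λ n → Limit.Marked.V-equation n k) (λ n → Limit.Marked.F-equation n k) ⟩
    treeSeries (rootOfSize k) ⊗ (# 3 ⊖ X ⊕ σ)
      ≈⟨ PS.*-cong (R-series k)
           (PS.+-cong (PS.+-congʳ (const-scalar 3)) (PS.sym σ≈√)) ⟨
    R k ⊗ numerator ∎
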